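{- Let $\mathcal{T} = (P,Q,\epsilon_1,\epsilon_2)$ be a Pultr template such that the central Pultr functor $\Gamma_{\mathcal{T}}$ admits a right adjoint $\Omega_{\mathcal{T}}$, that is, there is a digraph functor $\Omega_{\mathcal{T}}$ such that for all digraphs $G,H$, $\Gamma_{\mathcal{T}}(G)\to H$ if and only if $G\to\Omega_{\mathcal{T}}(H)$. Then $P$ and $Q$ are each homomorphically equivalent to a tree. Moreover, for any tree $T$, the digraph $\Lambda_{\mathcal{T}}(T)$ is homomorphically equivalent to a tree.
   Context: A digraph $G$ is a finite vertex set $V(G)$ (possibly empty) with an arc set $A(G)\subseteq V(G)\times V(G)$ (loops allowed). A homomorphism is an arc-preserving map of vertices; $G\to H$ means that a homomorphism of $G$ to $H$ exists; $G$ and $H$ are homomorphically equivalent if $G\to H$ and $H\to G$. A tree is a digraph obtained by orienting each edge of a (nonempty, finite) undirected tree in exactly one direction. A digraph functor is a construction $\Gamma$ assigning a digraph $\Gamma(G)$ to every digraph $G$ such that $G\to H$ implies $\Gamma(G)\to\Gamma(H)$. A Pultr template is a quadruple $\mathcal{T}=(P,Q,\epsilon_1,\epsilon_2)$ where $P,Q$ are digraphs and $\epsilon_1,\epsilon_2$ are homomorphisms of $P$ to $Q$. Central Pultr functor: for a digraph $H$, the vertices of $\Gamma_{\mathcal{T}}(H)$ are the homomorphisms $g:P\to H$, and the arcs are the couples $(g_1,g_2)$ for which there exists a homomorphism $h:Q\to H$ with $g_1=h\circ\epsilon_1$ and $g_2=h\circ\epsilon_2$. Left Pultr functor: for a digraph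 $G$, $\Lambda_{\mathcal{T}}(G)$ is obtained from the disjoint union of one copy $P_u$ of $P$ for every vertex $u$ of $G$ and one copy $Q_{u,v}$ of $Q$ for every arc $(u,v)$ of $G$, by identifying, for every arc $(u,v)$ of $G$ and every vertex $x$ of $P$, the copy of $x$ in $P_u$ with the copy of $\epsilon_1(x)$ in $Q_{u,v}$, and the copy of $x$ in $P_v$ with the copy of $\epsilon_2(x)$ in $Q_{u,v}$ (that is, taking the quotient by the equivalence relation generated by these identifications, the arcs being the images of arcs). -}

module Defs where

open import Data.Empty using (⊥-elim)
open import Data.Fin.Base using (Fin; zero; suc; inject₁; fromℕ; finToFun; funToFin)
open import Data.Fin.Properties using (all?; finToFun-funToFin)
open import Data.List.Base using (List; []; _∷_; _++_; map; mapMaybe; lookup; length; allFin; cartesianProduct)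
open import Data.List.Membership.Propositional.Properties using (∈-allFin)
import Data.List.Membership.Setoid as Membership
open import Data.List.Relation.Unary.Any as Any using (Any; here; there; any?; index)
import Data.List.Relation.Unary.Any.Properties as Anyₚ
open import Data.List.Relation.Unary.All as All using (All; []; _∷_)
import Data.List.Relation.Unary.All.Properties as Allₚ
open import Data.List.Relation.Unary.Enumerates.Setoid using (IsEnumeration)
import Data.List.Relation.Unary.Enumerates.Setoid.Properties as Enumₚ
open import Data.Maybe.Base using (Maybe; just; nothing)
import Data.Maybe.Relation.Unary.Any as MAny
open import Data.Nat.Base using (ℕ; _+_; _^_)
open import Data.Product.Base using (∃; _×_; _,_; proj₁; proj₂; uncurry)
open import Data.Product.Relation.Binary.Pointwise.NonDependent using (_×ₛ_; ×-decSetoid)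
open import Data.Sum.Base using (_⊎_; inj₁; inj₂; [_,_])
open import Data.Sum.Relation.Binary.Pointwise using (⊎-decSetoid; inj₁; inj₂)
open import Function.Base using (_∘_)
open import Function.Bundles using (_⇔_)
open import Function.Definitions using (Congruent; Injective)
open import Level using (0ℓ)
open import Relation.Binary.Bundles using (Setoid; DecSetoid)
open import Relation.Binary.Core using (Rel; _⇒_)
open import Relation.Binary.Construct.Closure.Equivalence as EqC using (EqClosure)
open import Relation.Binary.Construct.Closure.Symmetric using (SymClosure)
open import Relation.Binary.Construct.Union using (_∪_)
import Relation.Binary.Construct.On as On
open import Relation.Binary.Definitions using (Decidable; Asymmetric; _Respects_; _Respects₂_)
open import Relation.Binary.PropositionalEquality.Core as ≡ using (_≡_)
open import Relation.Nullary using (¬_; Dec; yes; no)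
open import Relation.Nullary.Decidable using (map′; _×-dec_; _⊎-dec_; _→-dec_)
open import Relation.Unary as U using (Pred)

-- The vertex set is a setoid, so that quotients and sets of
-- homomorphisms are vertex sets on the nose.  Finiteness is a list that
-- meets every ≈-class, with decidable ≈; the arc set, being a subset of
-- a finite set, is decidable.
record Digraph : Set₁ where
  infix 4 _⇒ᵍ_
  field
    vertices : DecSetoid 0ℓ 0ℓ
  open DecSetoid vertices public
    using (_≈_; _≟_; refl; sym; trans; setoid) renaming (Carrier to V)
  field
    enum       : List V
    enumerates : IsEnumeration setoid enum
    _⇒ᵍ_       : Rel V 0ℓ
    ⇒-resp-≈   : _⇒ᵍ_ Respects₂ _≈_
    _⇒?_       : Decidable _⇒ᵍ_

  ⇒-resp : ∀ {u u′ v v′} → u ≈ u′ → v ≈ v′ → u ⇒ᵍ v → u′ ⇒ᵍ v′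
  ⇒-resp u≈u′ v≈v′ = proj₂ ⇒-resp-≈ u≈u′ ∘ proj₁ ⇒-resp-≈ v≈v′

open Digraph using (V; enum; enumerates)

infix 4 _[_≈_] _[_⇒_]

_[_≈_] : (G : Digraph) → Rel (V G) 0ℓ
G [ u ≈ v ] = Digraph._≈_ G u v

_[_⇒_] : (G : Digraph) → Rel (V G) 0ℓ
G [ u ⇒ v ] = Digraph._⇒ᵍ_ G u v

record Hom (G H : Digraph) : Set where
  field
    to       : V G → V H
    cong     : Congruent (Digraph._≈_ G) (Digraph._≈_ H) to
    preserve : ∀ {u v} → G [ u ⇒ v ] → H [ to u ⇒ to v ]

open Hom

infixr 9 _∘ʰ_

_∘ʰ_ : ∀ {G H K} → Hom H K → Hom G H → Hom G K
g ∘ʰ f = record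
  { to       = to g ∘ to f
  ; cong     = cong g ∘ cong f
  ; preserve = preserve g ∘ preserve f
  }

infix 4 _≗ʰ_

_≗ʰ_ : ∀ {G H} → Rel (Hom G H) 0ℓ
_≗ʰ_ {G} {H} f g = ∀ x → H [ to f x ≈ to g x ]

HomEquivalent : Rel Digraph 0ℓ
HomEquivalent G H = Hom G H × Hom H G

module _ (G : Digraph) where

  open Digraph G using (_≈_; _⇒ᵍ_)

  record Cycle : Set where
    field
      k         : ℕ
      at        : Fin (3 + k) → V G
      injective : Injective _≡_ _≈_ at
      step      : ∀ i → SymClosure _⇒ᵍ_ (at (inject₁ i)) (at (suc i))
      close     : SymClosure _⇒ᵍ_ (at (fromℕ (2 + k))) (at zero)

  -- The underlying undirected graph has edge relation SymClosure _⇒ᵍ_.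
  -- Asymmetry says that each edge has exactly one direction and, in
  -- particular, that there are no loops.
  record IsTree : Set where
    field
      nonempty   : V G
      asymmetric : Asymmetric _⇒ᵍ_
      connected  : ∀ u v → EqClosure (_≈_ ∪ _⇒ᵍ_) u v
      acyclic    : ¬ Cycle

EquivalentToTree : Digraph → Set₁
EquivalentToTree G = ∃ λ T → IsTree T × HomEquivalent G T

record DigraphFunctor : Set₁ where
  field
    obj : Digraph → Digraph
    hom : ∀ {G H} → Hom G H → Hom (obj G) (obj H)

open DigraphFunctor public

-- Adjointness for the existence of homomorphisms, not for a bijection of
-- hom-sets.
_⊣_ : DigraphFunctor → DigraphFunctor → Set₁
Γ ⊣ Ω = ∀ G H → Hom (obj Γ G) H ⇔ Hom G (obj Ω H)

HasRightAdjoint : DigraphFunctor → Set₁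
HasRightAdjoint Γ = ∃ λ Ω → Γ ⊣ Ω

record PultrTemplate : Set₁ where
  field
    P Q   : Digraph
    ε₁ ε₂ : Hom P Q

module _ (S : Setoid 0ℓ 0ℓ) {xs : List (Setoid.Carrier S)}
         (xs-enum : IsEnumeration S xs) where

  open Setoid S
  open Membership S using (_∈_; find; lose)

  ∃? : {R : Pred Carrier 0ℓ} → R Respects _≈_ → U.Decidable R → Dec (∃ R)
  ∃? resp R? = map′ (λ p → let x , _ , Rx = find p in x , Rx)
                    (λ (x , Rx) → lose resp (xs-enum x) Rx)
                    (any? R? xs)

module _ {A : Set} (S : Setoid 0ℓ 0ℓ) (f : A → Maybe (Setoid.Carrier S)) where

  open Setoid S
  open Membership S using (_∈_)

  ∈-mapMaybe : ∀ {y} {as : List A} → Any (λ a → MAny.Any (y ≈_) (f a)) as →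
               y ∈ mapMaybe f as
  ∈-mapMaybe p = Anyₚ.mapMaybe⁺ f _ (Anyₚ.map⁺ p)

module HomSet (G H : Digraph) where

  private
    module G = Digraph G
    module H = Digraph H

  decSetoid : DecSetoid 0ℓ 0ℓ
  decSetoid = record
    { Carrier = Hom G H
    ; _≈_     = _≗ʰ_
    ; isDecEquivalence = record
      { isEquivalence = record
        { refl  = λ _ → H.refl
        ; sym   = λ p x → H.sym (p x)
        ; trans = λ p q x → H.trans (p x) (q x)
        }
      ; _≟_ = dec
      }
    }
    where
    dec : Decidable (_≗ʰ_ {G} {H})
    dec f g = map′
      (λ a x → let y , (x≈y , eq) = lookupAll (enumerates G x) a in
         H.trans (cong f x≈y) (H.trans eq (H.sym (cong g x≈y))))
      (λ p → All.universal p (enum G))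
      (All.all? (λ x → to f x H.≟ to g x) (enum G))
      where
      lookupAll : ∀ {R : Pred (V G) 0ℓ} {x xs} → Any (x G.≈_) xs → All R xs →
                  ∃ λ y → x G.≈ y × R y
      lookupAll (here x≈y) (Ry ∷ _) = _ , x≈y , Ry
      lookupAll (there p)  (_ ∷ a)  = lookupAll p a

  open DecSetoid decSetoid public using (setoid)

  private
    m = length (enum H)
    n = length (enum G)

    e : Fin n → V G
    e = lookup (enum G)

    d : Fin m → V H
    d = lookup (enum H)

    eᵢ : V G → Fin n
    eᵢ v = index (enumerates G v)

    dᵢ : V H → Fin m
    dᵢ v = index (enumerates H v)

    e-eᵢ : ∀ v → v G.≈ e (eᵢ v)
    e-eᵢ v = Anyₚ.lookup-index (enumerates G v)

    d-dᵢ : ∀ v → v H.≈ d (dᵢ v)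
    d-dᵢ v = Anyₚ.lookup-index (enumerates H v)

    Good : (Fin n → Fin m) → Set
    Good f = ∀ i j → (e i G.≈ e j → d (f i) H.≈ d (f j)) ×
                     (e i G.⇒ᵍ e j → d (f i) H.⇒ᵍ d (f j))

    good? : U.Decidable Good
    good? f = all? λ i → all? λ j →
      ((e i G.≟ e j) →-dec (d (f i) H.≟ d (f j))) ×-dec
      ((e i G.⇒? e j) →-dec (d (f i) H.⇒? d (f j)))

    fromTable : ∀ f → Good f → Hom G H
    fromTable f good = record
      { to       = λ v → d (f (eᵢ v))
      ; cong     = λ {u} {v} u≈v → proj₁ (good _ _)
                     (G.trans (G.sym (e-eᵢ u)) (G.trans u≈v (e-eᵢ v)))
      ; preserve = λ {u} {v} u⇒v → proj₂ (good _ _)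
                     (G.⇒-resp (e-eᵢ u) (e-eᵢ v) u⇒v)
      }

    tryTable : Fin (m ^ n) → Maybe (Hom G H)
    tryTable t with good? (finToFun t)
    ... | yes good = just (fromTable _ good)
    ... | no _     = nothing

    module _ (h : Hom G H) where

      table : Fin (m ^ n)
      table = funToFin (λ i → dᵢ (to h (e i)))

      table-≈ : ∀ i → to h (e i) H.≈ d (finToFun table i)
      table-≈ i = ≡.subst (λ j → to h (e i) H.≈ d j)
        (≡.sym (finToFun-funToFin (λ i → dᵢ (to h (e i))) i)) (d-dᵢ _)

      table-good : Good (finToFun table)
      table-good i j =
        (λ p → H.trans (H.sym (table-≈ i)) (H.trans (cong h p) (table-≈ j))) ,
        (λ p → H.⇒-resp (table-≈ i) (table-≈ j) (preserve h p))

      try-table : MAny.Any (h ≗ʰ_) (tryTable table)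
      try-table with good? (finToFun table)
      ... | yes good = MAny.just λ v → H.trans (cong h (e-eᵢ v)) (table-≈ (eᵢ v))
      ... | no ¬good = ⊥-elim (¬good table-good)

  homs : List (Hom G H)
  homs = mapMaybe tryTable (allFin (m ^ n))

  homs-enumerates : IsEnumeration setoid homs
  homs-enumerates h = ∈-mapMaybe setoid tryTable {y = h}
    (Any.map (λ { ≡.refl → try-table h }) (∈-allFin (table h)))

module _ (𝒯 : PultrTemplate) where

  open PultrTemplate 𝒯

  centralObj : Digraph → Digraph
  centralObj H = record
    { vertices   = HomSet.decSetoid P H
    ; enum       = HomSet.homs P H
    ; enumerates = HomSet.homs-enumerates P H
    ; _⇒ᵍ_       = λ g₁ g₂ → ∃ λ (h : Hom Q H) → g₁ ≗ʰ h ∘ʰ ε₁ × g₂ ≗ʰ h ∘ʰ ε₂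
    ; ⇒-resp-≈   =
        (λ p (h , q₁ , q₂) → h , q₁ , (λ x → trans (sym (p x)) (q₂ x))) ,
        (λ p (h , q₁ , q₂) → h , (λ x → trans (sym (p x)) (q₁ x)) , q₂)
    ; _⇒?_       = λ g₁ g₂ → ∃? (HomSet.setoid Q H) (HomSet.homs-enumerates Q H)
        (λ p (q₁ , q₂) → (λ x → trans (q₁ x) (p (to ε₁ x))) ,
                         (λ x → trans (q₂ x) (p (to ε₂ x))))
        (λ h → (g₁ ≟ʰ h ∘ʰ ε₁) ×-dec (g₂ ≟ʰ h ∘ʰ ε₂))
    }
    where
    open Digraph H using (sym; trans)
    open DecSetoid (HomSet.decSetoid P H) using () renaming (_≟_ to _≟ʰ_)

  centralPultr : DigraphFunctor
  centralPultr = record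
    { obj = centralObj
    ; hom = λ f → record
      { to       = f ∘ʰ_
      ; cong     = λ p x → cong f (p x)
      ; preserve = λ (h , q₁ , q₂) →
          f ∘ʰ h , (λ x → cong f (q₁ x)) , (λ x → cong f (q₂ x))
      }
    }

module _ (S : DecSetoid 0ℓ 0ℓ) where

  open DecSetoid S renaming (Carrier to A)

  module _ (a b : A) where

    collapse : A → A
    collapse x with x ≟ a
    ... | yes _ = b
    ... | no _  = x

    collapse-cong : ∀ {x y} → x ≈ y → collapse x ≈ collapse y
    collapse-cong {x} {y} x≈y with x ≟ a | y ≟ a
    ... | yes _   | yes _   = refl
    ... | yes x≈a | no y≉a  = ⊥-elim (y≉a (trans (sym x≈y) x≈a))
    ... | no x≉a  | yes y≈a = ⊥-elim (x≉a (trans x≈y y≈a))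
    ... | no _    | no _    = x≈y

    collapse-merge : collapse a ≈ collapse b
    collapse-merge with a ≟ a | b ≟ a
    ... | yes _  | yes _ = refl
    ... | yes _  | no _  = refl
    ... | no a≉a | _     = ⊥-elim (a≉a refl)

    collapse-sound : ∀ x → collapse x ≡ x ⊎ (x ≈ a × collapse x ≡ b)
    collapse-sound x with x ≟ a
    ... | yes x≈a = inj₂ (x≈a , ≡.refl)
    ... | no _    = inj₁ ≡.refl

  canon : List (A × A) → A → A
  canon []             x = x
  canon ((a , b) ∷ ps) x = collapse (canon ps a) (canon ps b) (canon ps x)

  canon-cong : ∀ ps {x y} → x ≈ y → canon ps x ≈ canon ps y
  canon-cong []       x≈y = x≈y
  canon-cong (_ ∷ ps) x≈y = collapse-cong _ _ (canon-cong ps x≈y)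

  canon-merge : ∀ {ps x y} → Any (λ (a , b) → x ≈ a × y ≈ b) ps →
                canon ps x ≈ canon ps y
  canon-merge {_ ∷ ps} (here (x≈a , y≈b)) =
    trans (collapse-cong _ _ (canon-cong ps x≈a))
      (trans (collapse-merge _ _) (sym (collapse-cong _ _ (canon-cong ps y≈b))))
  canon-merge {_ ∷ ps} (there p) = collapse-cong _ _ (canon-merge p)

  module _ {R : Rel A 0ℓ} (≈⇒R : _≈_ ⇒ EqClosure R) where

    private
      module R = Setoid (EqC.setoid R)

    canon-sound : ∀ {ps} → All (uncurry (EqClosure R)) ps →
                  ∀ x → EqClosure R x (canon ps x)
    canon-sound [] x = R.refl
    canon-sound {(a , b) ∷ ps} (aRb ∷ qs) x
      with collapse-sound (canon ps a) (canon ps b) (canon ps x)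
    ... | inj₁ eq        rewrite eq = canon-sound qs x
    ... | inj₂ (eq , eq′) rewrite eq′ =
      R.trans (canon-sound qs x) (R.trans (≈⇒R eq)
        (R.trans (R.sym (canon-sound qs a)) (R.trans aRb (canon-sound qs b))))

    EqClosure? : ∀ {ps} → All (uncurry (EqClosure R)) ps →
                 (∀ {x y} → R x y → x ≈ y ⊎ Any (λ (a , b) → x ≈ a × y ≈ b) ps) →
                 Decidable (EqClosure R)
    EqClosure? {ps} sound complete x y = map′
      (λ eq → R.trans (canon-sound sound x)
                (R.trans (≈⇒R eq) (R.sym (canon-sound sound y))))
      (EqC.gfold isEquivalence (canon ps)
        (λ r → [ canon-cong ps , canon-merge ] (complete r)))
      (canon ps x ≟ canon ps y)

module ArcSet (G : Digraph) where

  private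
    module G = Digraph G

  record Arc : Set where
    constructor arc
    field
      {source target} : V G
      isArc           : G [ source ⇒ target ]

  open Arc public

  ends : Arc → V G × V G
  ends a = source a , target a

  -- An arc is its pair of ends: the proof that the pair lies in the arc
  -- set is ignored.
  decSetoid : DecSetoid 0ℓ 0ℓ
  decSetoid = record
    { isDecEquivalence = On.isDecEquivalence ends
        (DecSetoid.isDecEquivalence (×-decSetoid G.vertices G.vertices)) }

  open DecSetoid decSetoid public using (setoid; _≈_)

  private
    pairs : List (V G × V G)
    pairs = cartesianProduct (enum G) (enum G)

    tryPair : V G × V G → Maybe Arc
    tryPair (u , v) with u G.⇒? v
    ... | yes u⇒v = just (arc u⇒v)
    ... | no _    = nothing

    try-pair : ∀ a {p} → Setoid._≈_ (G.setoid ×ₛ G.setoid) (ends a) p →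
               MAny.Any (a ≈_) (tryPair p)
    try-pair a {u , v} (p , q) with u G.⇒? v
    ... | yes _   = MAny.just (p , q)
    ... | no ¬u⇒v = ⊥-elim (¬u⇒v (G.⇒-resp p q (isArc a)))

  arcs : List Arc
  arcs = mapMaybe tryPair pairs

  arcs-enumerates : IsEnumeration setoid arcs
  arcs-enumerates a = ∈-mapMaybe setoid tryPair {y = a}
    (Any.map (try-pair a)
      (Enumₚ.cartesianProduct⁺ G.setoid G.setoid (enumerates G) (enumerates G) (ends a)))

module LeftPultr (𝒯 : PultrTemplate) (G : Digraph) where

  open PultrTemplate 𝒯
  private
    module G = Digraph G
    module P = Digraph P
    module Q = Digraph Q
  open ArcSet G

  -- The disjoint union: inj₁ (u , x) is the copy of x in P_u, and
  -- inj₂ (a , x) is the copy of x in Q_a.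
  copies : DecSetoid 0ℓ 0ℓ
  copies = ⊎-decSetoid (×-decSetoid G.vertices P.vertices)
                       (×-decSetoid (ArcSet.decSetoid G) Q.vertices)

  open DecSetoid copies using () renaming (Carrier to Copy; _≈_ to _≈ᶜ_; refl to reflᶜ)

  data Glue : Rel Copy 0ℓ where
    same  : ∀ {s t} → s ≈ᶜ t → Glue s t
    glue₁ : ∀ a x → Glue (inj₁ (source a , x)) (inj₂ (a , to ε₁ x))
    glue₂ : ∀ a x → Glue (inj₁ (target a , x)) (inj₂ (a , to ε₂ x))

  infix 4 _≈ᴸ_ _⇒ᴸ_

  _≈ᴸ_ : Rel Copy 0ℓ
  _≈ᴸ_ = EqClosure Glue

  data _⇒ᴸ_ (s t : Copy) : Set where
    imageP : ∀ u {x y} → P [ x ⇒ y ] →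
             s ≈ᴸ inj₁ (u , x) → t ≈ᴸ inj₁ (u , y) → s ⇒ᴸ t
    imageQ : ∀ a {x y} → Q [ x ⇒ y ] →
             s ≈ᴸ inj₂ (a , x) → t ≈ᴸ inj₂ (a , y) → s ⇒ᴸ t

  private
    module L = Setoid (EqC.setoid Glue)

    left right : Arc × V P → Copy × Copy
    left  (a , x) = inj₁ (source a , x) , inj₂ (a , to ε₁ x)
    right (a , x) = inj₁ (target a , x) , inj₂ (a , to ε₂ x)

    index-pairs : List (Arc × V P)
    index-pairs = cartesianProduct arcs (enum P)

    ∈-index-pairs : ∀ a x → Any (λ (b , y) → a ≈ b × x P.≈ y) index-pairs
    ∈-index-pairs a x = Enumₚ.cartesianProduct⁺ (ArcSet.setoid G) P.setoid
      arcs-enumerates (enumerates P) (a , x)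

    gluePairs : List (Copy × Copy)
    gluePairs = map left index-pairs ++ map right index-pairs

    sound : All (uncurry _≈ᴸ_) gluePairs
    sound = Allₚ.++⁺
      (Allₚ.map⁺ (All.universal (λ (a , x) → EqC.return (glue₁ a x)) index-pairs))
      (Allₚ.map⁺ (All.universal (λ (a , x) → EqC.return (glue₂ a x)) index-pairs))

    complete : ∀ {s t} → Glue s t →
               s ≈ᶜ t ⊎ Any (λ (a , b) → s ≈ᶜ a × t ≈ᶜ b) gluePairs
    complete (same p)    = inj₁ p
    complete (glue₁ a x) = inj₂ (Anyₚ.++⁺ˡ (Anyₚ.map⁺ (Any.map
      (λ (p , q) → inj₁ (proj₁ p , q) , inj₂ (p , cong ε₁ q)) (∈-index-pairs a x))))
    complete (glue₂ a x) = inj₂ (Anyₚ.++⁺ʳ _ (Anyₚ.map⁺ (Any.map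
      (λ (p , q) → inj₁ (proj₂ p , q) , inj₂ (p , cong ε₂ q)) (∈-index-pairs a x))))

    _≟ᴸ_ : Decidable _≈ᴸ_
    _≟ᴸ_ = EqClosure? copies (EqC.return ∘ same) sound complete

    same′ : ∀ {s t} → s ≈ᶜ t → s ≈ᴸ t
    same′ = EqC.return ∘ same

    _⇒ᴸ?_ : Decidable _⇒ᴸ_
    s ⇒ᴸ? t = map′
      (λ { (inj₁ (u , x , y , e , p , q)) → imageP u e p q
         ; (inj₂ (a , x , y , e , p , q)) → imageQ a e p q })
      (λ { (imageP u e p q) → inj₁ (u , _ , _ , e , p , q)
         ; (imageQ a e p q) → inj₂ (a , _ , _ , e , p , q) })
      (  (∃? G.setoid (enumerates G)
           (λ u≈u′ (x , y , e , p , q) → x , y , e ,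
              L.trans p (same′ (inj₁ (u≈u′ , P.refl))) ,
              L.trans q (same′ (inj₁ (u≈u′ , P.refl))))
           λ u → ∃? P.setoid (enumerates P)
             (λ x≈x′ (y , e , p , q) → y , P.⇒-resp x≈x′ P.refl e ,
                L.trans p (same′ (inj₁ (G.refl , x≈x′))) , q)
             λ x → ∃? P.setoid (enumerates P)
               (λ y≈y′ (e , p , q) → P.⇒-resp P.refl y≈y′ e , p ,
                  L.trans q (same′ (inj₁ (G.refl , y≈y′))))
               λ y → (x P.⇒? y) ×-dec ((s ≟ᴸ inj₁ (u , x)) ×-dec (t ≟ᴸ inj₁ (u , y))))
      ⊎-dec (∃? (ArcSet.setoid G) arcs-enumerates
           (λ a≈a′ (x , y , e , p , q) → x , y , e ,
              L.trans p (same′ (inj₂ (a≈a′ , Q.refl))) ,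
              L.trans q (same′ (inj₂ (a≈a′ , Q.refl))))
           λ a → ∃? Q.setoid (enumerates Q)
             (λ x≈x′ (y , e , p , q) → y , Q.⇒-resp x≈x′ Q.refl e ,
                L.trans p (same′ (inj₂ ((G.refl , G.refl) , x≈x′))) , q)
             λ x → ∃? Q.setoid (enumerates Q)
               (λ y≈y′ (e , p , q) → Q.⇒-resp Q.refl y≈y′ e , p ,
                  L.trans q (same′ (inj₂ ((G.refl , G.refl) , y≈y′))))
               λ y → (x Q.⇒? y) ×-dec ((s ≟ᴸ inj₂ (a , x)) ×-dec (t ≟ᴸ inj₂ (a , y)))))

    copyList : List Copy
    copyList = map inj₁ (cartesianProduct (enum G) (enum P))
            ++ map inj₂ (cartesianProduct arcs (enum Q))

    copyList-enumerates : IsEnumeration (DecSetoid.setoid copies) copyList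
    copyList-enumerates = Enumₚ.++⁺ (G.setoid ×ₛ P.setoid) (ArcSet.setoid G ×ₛ Q.setoid)
      (Enumₚ.cartesianProduct⁺ G.setoid P.setoid (enumerates G) (enumerates P))
      (Enumₚ.cartesianProduct⁺ (ArcSet.setoid G) Q.setoid arcs-enumerates (enumerates Q))

  leftObj : Digraph
  leftObj = record
    { vertices   = record
      { Carrier          = Copy
      ; _≈_              = _≈ᴸ_
      ; isDecEquivalence = record
        { isEquivalence = EqC.isEquivalence Glue
        ; _≟_           = _≟ᴸ_
        }
      }
    ; enum       = copyList
    ; enumerates = λ s → Any.map same′ (copyList-enumerates s)
    ; _⇒ᵍ_       = _⇒ᴸ_
    ; ⇒-resp-≈   =
        (λ { eq (imageP u e p q) → imageP u e p (L.trans (L.sym eq) q)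
           ; eq (imageQ a e p q) → imageQ a e p (L.trans (L.sym eq) q) }) ,
        (λ { eq (imageP u e p q) → imageP u e (L.trans (L.sym eq) p) q
           ; eq (imageQ a e p q) → imageQ a e (L.trans (L.sym eq) p) q })
    ; _⇒?_       = _⇒ᴸ?_
    }

leftPultr : PultrTemplate → DigraphFunctor
leftPultr 𝒯 = record { obj = leftObj 𝒯 ; hom = leftHom }
  where
  open LeftPultr using (leftObj; Glue; same; glue₁; glue₂; imageP; imageQ)
  open ArcSet using (arc)

  leftHom : ∀ {G H} → Hom G H → Hom (leftObj 𝒯 G) (leftObj 𝒯 H)
  leftHom {G} {H} f = record
    { to       = f′
    ; cong     = cong′
    ; preserve = λ { (imageP u e p q) → imageP (to f u) e (cong′ p) (cong′ q)
                   ; (imageQ (arc a) e p q) →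
                       imageQ (arc (preserve f a)) e (cong′ p) (cong′ q) }
    }
    where
    f′ : V (leftObj 𝒯 G) → V (leftObj 𝒯 H)
    f′ (inj₁ (u , x))     = inj₁ (to f u , x)
    f′ (inj₂ (arc a , x)) = inj₂ (arc (preserve f a) , x)

    glue′ : ∀ {s t} → Glue 𝒯 G s t → Glue 𝒯 H (f′ s) (f′ t)
    glue′ (same (inj₁ (p , q)))         = same (inj₁ (cong f p , q))
    glue′ (same (inj₂ ((p , p′) , q))) = same (inj₂ ((cong f p , cong f p′) , q))
    glue′ (glue₁ (arc a) x)             = glue₁ (arc (preserve f a)) x
    glue′ (glue₂ (arc a) x)             = glue₂ (arc (preserve f a)) x

    cong′ : ∀ {s t} → EqClosure (Glue 𝒯 G) s t → EqClosure (Glue 𝒯 H) (f′ s) (f′ t)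
    cong′ = EqC.gmap f′ glue′

{-# OPTIONS --safe #-}
module Submission where

-- Call D a dual of F if every digraph G satisfies exactly one of F → G
-- and G → D.  If D is a dual of a tree T, then Λ(T) → G iff T → Γ(G) iff
-- Γ(G) ↛ D iff G ↛ Ω(D), so Ω(D) is a dual of Λ(T); in the same way P and
-- Q inherit duals from the one-vertex tree and the one-arc tree.
--
-- Every tree has a dual: root T and let the dual consist of all labellings
-- that tell, for each node other than the root, whether the subtree at that
-- node maps to some suitable neighbour, such that T itself does not fit.
--
-- Conversely a digraph F with a dual D is equivalent to a tree.  Let F be a
-- core.  Given an arc (a, b), take many copies of F without that arc and
-- join a in copy i to b in copy j for i < j.  This digraph does not map to
-- D, since two copies would be coloured alike and give F → D.  So F maps to
-- it, and, F being a core, by a section of the projection to F; the copy it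
-- uses is constant on components of F without (a, b) but differs at a and
-- b, so (a, b) is a bridge.  Two nonempty parts of F without arcs between
-- them would both map to D, hence so would F.

open import Data.Bool.Base using (Bool; true; false)
import Data.Bool.Base as Bool
import Data.Bool.Properties as Boolₚ
open import Data.Empty using (⊥; ⊥-elim)
open import Data.Fin.Base as Fin using (Fin; zero; suc; inject₁; fromℕ; toℕ)
import Data.Fin.Properties as Finₚ
open import Data.List.Base using (List; []; _∷_; lookup; mapMaybe; length; cartesianProduct; allFin)
open import Data.List.Membership.Propositional using (_∈_)
open import Data.List.Membership.Propositional.Properties using (∈-allFin; ∈-cartesianProduct⁺)
open import Data.List.Properties using (length-mapMaybe)
import Data.List.Relation.Unary.All as All
import Data.List.Relation.Unary.All.Properties as Allₚ
open import Data.List.Relation.Unary.Any as Any using (Any; here; there; index)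
import Data.List.Relation.Unary.Any.Properties as Anyₚ
open import Data.List.Relation.Unary.Enumerates.Setoid using (IsEnumeration)
import Data.List.Relation.Unary.Enumerates.Setoid.Properties as Enumₚ
open import Data.Maybe.Base using (Maybe; just; nothing)
import Data.Maybe.Relation.Unary.Any as MAny
open import Data.Nat.Base using (ℕ; zero; suc; _+_; _<_; s≤s)
open import Data.Nat.Properties using (≤-refl; <-≤-trans; m≤n⇒m≤1+n; m≤n⇒∃[o]m+o≡n; +-comm)
open import Data.Product.Base using (∃; ∃₂; _×_; _,_; proj₁; proj₂)
open import Data.Product.Properties using (≡-dec)
open import Data.Product.Relation.Binary.Pointwise.NonDependent using (×-decSetoid)
open import Data.Sum.Base as Sum using (_⊎_; inj₁; inj₂; [_,_])
open import Data.Sum.Relation.Binary.Pointwise using (inj₁; inj₂)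
open import Data.Unit.Base using (⊤; tt)
open import Function.Base using (_∘_; id)
open import Function.Bundles using (Equivalence; mk⇔)
open import Level using (0ℓ)
open import Relation.Binary.Bundles using (Setoid; DecSetoid)
open import Relation.Binary.Core using (Rel)
open import Relation.Binary.Construct.Closure.Equivalence as EqC using (EqClosure)
open import Relation.Binary.Construct.Closure.ReflexiveTransitive using (ε; _◅_; _◅◅_)
open import Relation.Binary.Construct.Closure.Symmetric as SymC using (SymClosure; fwd; bwd)
import Relation.Binary.Construct.On as On
open import Relation.Binary.Construct.Union using (_∪_)
open import Relation.Binary.Definitions using (Decidable; _Respects_)
open import Relation.Binary.PropositionalEquality.Core as ≡ using (_≡_)
import Relation.Binary.PropositionalEquality.Properties as ≡ₚ
open import Relation.Nullary using (¬_; Dec; yes; no)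
open import Relation.Nullary.Decidable
  using (isYes; isYes≗does; does-⇔; toWitness; fromWitness; ¬?; _×-dec_; _⊎-dec_; _→-dec_; T?)
open import Relation.Unary as U using (Pred)

open import Defs

open Digraph using (V; enum; enumerates)
open Hom

private
  variable
    F G H : Digraph

-- Enumerations, induced subdigraphs and gluing.

idʰ : Hom G G
idʰ = record { to = id ; cong = id ; preserve = id }

index-injective : (S : Setoid 0ℓ 0ℓ) {xs : List (Setoid.Carrier S)}
                  (e : IsEnumeration S xs) → ∀ {x y} →
                  index (e x) ≡ index (e y) → Setoid._≈_ S x y
index-injective S {xs} e {x} {y} eq = S.trans (Anyₚ.lookup-index (e x))
  (≡.subst (λ i → lookup xs i S.≈ y) (≡.sym eq)
    (S.sym (Anyₚ.lookup-index (e y))))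
  where module S = Setoid S

pigeonhole : (S : Setoid 0ℓ 0ℓ) {xs : List (Setoid.Carrier S)} → IsEnumeration S xs →
             (f : Fin (suc (length xs)) → Setoid.Carrier S) →
             ∃₂ λ i j → i Fin.< j × Setoid._≈_ S (f i) (f j)
pigeonhole S e f with Finₚ.pigeonhole ≤-refl (λ i → index (e (f i)))
... | i , j , i<j , eq = i , j , i<j , index-injective S e eq

length-mapMaybe-< : {A B : Set} (f : A → Maybe B) {xs : List A} →
                    Any (λ x → f x ≡ nothing) xs → length (mapMaybe f xs) < length xs
length-mapMaybe-< f {x ∷ xs} (here eq) with f x
... | nothing = s≤s (length-mapMaybe f xs)
length-mapMaybe-< f {x ∷ xs} (there p) with f x
... | nothing = m≤n⇒m≤1+n (length-mapMaybe-< f p)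
... | just _  = s≤s (length-mapMaybe-< f p)

module Induced (G : Digraph) {p : Pred (V G) 0ℓ}
               (resp : p Respects Digraph._≈_ G) (p? : U.Decidable p) where

  private
    module G = Digraph G

    restrict : V G → Maybe (∃ p)
    restrict v with p? v
    ... | yes pv = just (v , pv)
    ... | no _   = nothing

    restrict-just : ∀ {v w} → p v → v G.≈ w → MAny.Any (λ x → v G.≈ proj₁ x) (restrict w)
    restrict-just {v} {w} pv v≈w with p? w
    ... | yes _  = MAny.just v≈w
    ... | no ¬pw = ⊥-elim (¬pw (resp v≈w pv))

    restrict-nothing : ∀ {v w} → ¬ p v → v G.≈ w → restrict w ≡ nothing
    restrict-nothing {v} {w} ¬pv v≈w with p? w
    ... | yes pw = ⊥-elim (¬pv (resp (G.sym v≈w) pw))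
    ... | no _   = ≡.refl

    decSetoid : DecSetoid 0ℓ 0ℓ
    decSetoid = record
      { isDecEquivalence = On.isDecEquivalence (proj₁ {B = p})
          (DecSetoid.isDecEquivalence G.vertices) }

  digraph : Digraph
  digraph = record
    { vertices   = decSetoid
    ; enum       = mapMaybe restrict (enum G)
    ; enumerates = λ v → ∈-mapMaybe (DecSetoid.setoid decSetoid) restrict {y = v}
        (Any.map (restrict-just (proj₂ v)) (enumerates G (proj₁ v)))
    ; _⇒ᵍ_       = λ u v → proj₁ u G.⇒ᵍ proj₁ v
    ; ⇒-resp-≈   = proj₁ G.⇒-resp-≈ , proj₂ G.⇒-resp-≈
    ; _⇒?_       = λ u v → proj₁ u G.⇒? proj₁ v
    }

  inclusion : Hom digraph G
  inclusion = record { to = proj₁ ; cong = id ; preserve = id }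

  -- The length of the vertex list, repetitions included, is the measure for the inductions below; a
  -- vertex outside `p` is equivalent to a listed one, which `restrict` drops.
  smaller : ∀ {v} → ¬ p v → length (enum digraph) < length (enum G)
  smaller ¬pv = length-mapMaybe-< restrict
    (Any.map (restrict-nothing ¬pv) (enumerates G _))

module Glue {G H : Digraph} {p q : Pred (V G) 0ℓ}
            (p-resp : p Respects Digraph._≈_ G) (p? : U.Decidable p)
            (q-resp : q Respects Digraph._≈_ G) (q? : U.Decidable q)
            (cover : ∀ v → p v ⊎ q v) (disjoint : ∀ {v} → p v → q v → ⊥) where

  private
    module G = Digraph G
    module H = Digraph H
    module P = Induced G p-resp p?
    module Q = Induced G q-resp q?

  module _ (f : Hom P.digraph H) (g : Hom Q.digraph H)
           (cross₁ : ∀ {u v} (pu : p u) (qv : q v) → G [ u ⇒ v ] →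
                     H [ to f (u , pu) ⇒ to g (v , qv) ])
           (cross₂ : ∀ {u v} (qu : q u) (pv : p v) → G [ u ⇒ v ] →
                     H [ to g (u , qu) ⇒ to f (v , pv) ]) where

    private
      -- The side is an argument because `cover` may answer equivalent vertices with different
      -- proofs; by `disjoint` they still lie on the same side.
      on : ∀ {v} → p v ⊎ q v → V H
      on = [ (λ pv → to f (_ , pv)) , (λ qv → to g (_ , qv)) ]

      on-cong : ∀ {u v} (s : p u ⊎ q u) (t : p v ⊎ q v) → u G.≈ v → on s H.≈ on t
      on-cong (inj₁ _)  (inj₁ _)  u≈v = cong f u≈v
      on-cong (inj₁ pu) (inj₂ qv) u≈v = ⊥-elim (disjoint (p-resp u≈v pu) qv)
      on-cong (inj₂ qu) (inj₁ pv) u≈v = ⊥-elim (disjoint pv (q-resp u≈v qu))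
      on-cong (inj₂ _)  (inj₂ _)  u≈v = cong g u≈v

      on-preserve : ∀ {u v} (s : p u ⊎ q u) (t : p v ⊎ q v) → G [ u ⇒ v ] → H [ on s ⇒ on t ]
      on-preserve (inj₁ _)  (inj₁ _)  e = preserve f e
      on-preserve (inj₁ pu) (inj₂ qv) e = cross₁ pu qv e
      on-preserve (inj₂ qu) (inj₁ pv) e = cross₂ qu pv e
      on-preserve (inj₂ _)  (inj₂ _)  e = preserve g e

    glue : Hom G H
    glue = record
      { to       = λ v → on (cover v)
      ; cong     = on-cong (cover _) (cover _)
      ; preserve = on-preserve (cover _) (cover _)
      }

    glue-p : ∀ {v} (pv : p v) → to glue v H.≈ to f (v , pv)
    glue-p pv = on-cong (cover _) (inj₁ pv) G.refl

    glue-q : ∀ {v} (qv : q v) → to glue v H.≈ to g (v , qv)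
    glue-q qv = on-cong (cover _) (inj₂ qv) G.refl

-- Connectedness, bridges and cycles

Step : (G : Digraph) → Rel (V G) 0ℓ
Step G = Digraph._≈_ G ∪ Digraph._⇒ᵍ_ G

Conn : (G : Digraph) → Rel (V G) 0ℓ
Conn G = EqClosure (Step G)

Adj : (G : Digraph) → Rel (V G) 0ℓ
Adj G = SymClosure (Digraph._⇒ᵍ_ G)

module _ (G : Digraph) where

  private
    module G = Digraph G

  open ArcSet G

  conn? : Decidable (Conn G)
  conn? = EqClosure? G.vertices (EqC.return ∘ inj₁)
    (Allₚ.map⁺ (All.universal (λ a → EqC.return (inj₂ (isArc a))) arcs))
    λ { (inj₁ u≈v) → inj₁ u≈v
      ; (inj₂ u⇒v) → inj₂ (Anyₚ.map⁺ {f = ends} (arcs-enumerates (arc u⇒v))) }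

  conn-≈ : ∀ {u v} → u G.≈ v → Conn G u v
  conn-≈ = EqC.return ∘ inj₁

  conn-⇒ : ∀ {u v} → G [ u ⇒ v ] → Conn G u v
  conn-⇒ = EqC.return ∘ inj₂

  conn-resp : ∀ {u} → (Conn G u) Respects G._≈_
  conn-resp v≈w c = c ◅◅ conn-≈ v≈w

  conn-sym : ∀ {u v} → Conn G u v → Conn G v u
  conn-sym = EqC.symmetric _

  conn-induction : {p : Pred (V G) 0ℓ} →
                   (∀ {u v} → SymClosure (Step G) u v → p u → p v) →
                   ∀ {u v} → Conn G u v → p u → p v
  conn-induction step ε       pu = pu
  conn-induction step (s ◅ c) pu = conn-induction step c (step s pu)

  adj-resp : ∀ {u u′ v} → u G.≈ u′ → Adj G u v → Adj G u′ v
  adj-resp u≈u′ (fwd e) = fwd (G.⇒-resp u≈u′ G.refl e)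
  adj-resp u≈u′ (bwd e) = bwd (G.⇒-resp G.refl u≈u′ e)

module _ (G : Digraph) (a b : V G) where

  private
    module G = Digraph G

  deleteArc : Digraph
  deleteArc = record
    { vertices   = G.vertices
    ; enum       = G.enum
    ; enumerates = G.enumerates
    ; _⇒ᵍ_       = λ u v → G [ u ⇒ v ] × ¬ (u G.≈ a × v G.≈ b)
    ; ⇒-resp-≈   =
        (λ p (e , n) → G.⇒-resp G.refl p e , λ (q , r) → n (q , G.trans p r)) ,
        (λ p (e , n) → G.⇒-resp p G.refl e , λ (q , r) → n (G.trans p q , r))
    ; _⇒?_       = λ u v → (u G.⇒? v) ×-dec ¬? ((u G.≟ a) ×-dec (v G.≟ b))
    }

-- Only the arc `(a , b)` is deleted: an opposite arc stays, and equivalent ends remain connected.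
-- The condition thus excludes loops and two-way edges as well as cycles.
Bridged : Digraph → Set
Bridged G = ∀ {a b} → G [ a ⇒ b ] → ¬ Conn (deleteArc G a b) a b

module Paths (G : Digraph) where

  private
    module G = Digraph G

  infixr 5 _∷_

  data Path : Rel (V G) 0ℓ where
    end : ∀ {u v} → u G.≈ v → Path u v
    _∷_ : ∀ {u v w} → Adj G u v → Path v w → Path u w

  size : ∀ {u v} → Path u v → ℕ
  size (end _) = 0
  size (_ ∷ p) = suc (size p)

  at : ∀ {u v} (p : Path u v) → Fin (suc (size p)) → V G
  at {u} _       zero    = u
  at     (_ ∷ p) (suc i) = at p i

  Simple : ∀ {u v} → Path u v → Set
  Simple     (end _) = ⊤
  Simple {u} (_ ∷ p) = (∀ i → ¬ u G.≈ at p i) × Simple p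

  at-injective : ∀ {u v} (p : Path u v) → Simple p → ∀ {i j} → at p i G.≈ at p j → i ≡ j
  at-injective p       s       {zero}  {zero}  _  = ≡.refl
  at-injective (_ ∷ p) (n , s) {zero}  {suc j} eq = ⊥-elim (n j eq)
  at-injective (_ ∷ p) (n , s) {suc i} {zero}  eq = ⊥-elim (n i (G.sym eq))
  at-injective (_ ∷ p) (n , s) {suc i} {suc j} eq = ≡.cong suc (at-injective p s eq)

  at-step : ∀ {u v} (p : Path u v) i → Adj G (at p (inject₁ i)) (at p (suc i))
  at-step (e ∷ p) zero    = e
  at-step (_ ∷ p) (suc i) = at-step p i

  at-last : ∀ {u v} (p : Path u v) → at p (fromℕ (size p)) G.≈ v
  at-last (end u≈v) = u≈v
  at-last (_ ∷ p)   = at-last p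

  SimplePath : Rel (V G) 0ℓ
  SimplePath u v = ∃ λ (p : Path u v) → Simple p

  restart : ∀ {u u′ v} → u G.≈ u′ → SimplePath u′ v → SimplePath u v
  restart eq (end p , _)       = end (G.trans eq p) , tt
  restart eq (e ∷ p , (n , s)) =
    adj-resp G (G.sym eq) e ∷ p , (λ i q → n i (G.trans (G.sym eq) q)) , s

  suffix : ∀ {u v w} (p : Path v w) → Simple p → ∀ i → u G.≈ at p i → SimplePath u w
  suffix p       s       zero    eq = restart eq (p , s)
  suffix (_ ∷ p) (_ , s) (suc i) eq = suffix p s i eq

  -- If `u` already lies on the path, the detour back to it is dropped and only the suffix from
  -- there is kept.
  cons : ∀ {u v w} → Adj G u v → SimplePath v w → SimplePath u w
  cons {u} e (p , s) with Finₚ.any? (λ i → u G.≟ at p i)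
  ... | yes (i , eq) = suffix p s i eq
  ... | no n         = e ∷ p , (λ i q → n (i , q)) , s

  simplePath : ∀ {u v} → Conn G u v → SimplePath u v
  simplePath ε                    = end G.refl , tt
  simplePath (fwd (inj₁ eq) ◅ c) = restart eq (simplePath c)
  simplePath (bwd (inj₁ eq) ◅ c) = restart (G.sym eq) (simplePath c)
  simplePath (fwd (inj₂ e) ◅ c)  = cons (fwd e) (simplePath c)
  simplePath (bwd (inj₂ e) ◅ c)  = cons (bwd e) (simplePath c)

-- The deleted arc closes a simple path from `b` to `a` to a cycle. Paths too short for a cycle are
-- excluded apart: length zero makes the arc a loop, and a single edge would be the opposite or the
-- deleted arc.
tree⇒bridged : IsTree G → Bridged G
tree⇒bridged {G} tree {a} {b} a⇒b c
  with Paths.simplePath (deleteArc G a b) (conn-sym (deleteArc G a b) c)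
... | p , s = impossible p s
  where
  module G = Digraph G
  open IsTree tree
  open Paths (deleteArc G a b)

  impossible : (p : Path b a) → Simple p → ⊥
  impossible (end b≈a) _ =
    asymmetric (G.⇒-resp G.refl b≈a a⇒b) (G.⇒-resp G.refl b≈a a⇒b)
  impossible (fwd (b⇒v , _) ∷ end v≈a) _ =
    asymmetric a⇒b (G.⇒-resp G.refl v≈a b⇒v)
  impossible (bwd (_ , ≉) ∷ end v≈a) _ = ≉ (v≈a , G.refl)
  impossible p@(_ ∷ _ ∷ q) s = acyclic record
    { k         = size q
    ; at        = at p
    ; injective = at-injective p s
    ; step      = λ i → SymC.map proj₁ (at-step p i)
    ; close     = fwd (G.⇒-resp (G.sym (at-last p)) G.refl a⇒b)
    }

module _ {G : Digraph} (bridged : Bridged G) where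

  private
    module G = Digraph G

  bridged⇒asymmetric : ∀ {u v} → G [ u ⇒ v ] → ¬ G [ v ⇒ u ]
  bridged⇒asymmetric {u} {v} u⇒v v⇒u with u G.≟ v
  ... | yes u≈v = bridged u⇒v (conn-≈ (deleteArc G u v) u≈v)
  ... | no u≉v  = bridged u⇒v (conn-sym (deleteArc G u v)
                    (conn-⇒ (deleteArc G u v) (v⇒u , λ (v≈u , _) → u≉v (G.sym v≈u))))

  module _ (c : Cycle G) where

    open Cycle c

    private
      last : Fin (3 + k)
      last = fromℕ (2 + k)

      along : ∀ {n} (x : Fin (suc n) → V G) {a b} →
              (∀ i → Conn (deleteArc G a b) (x (inject₁ i)) (x (suc i))) →
              Conn (deleteArc G a b) (x zero) (x (fromℕ n))
      along {zero}  x s = ε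
      along {suc n} x s = s zero ◅◅ along (x ∘ suc) (s ∘ suc)

      around : ∀ {a b} → (∀ i → ¬ (at (inject₁ i) G.≈ a × at (suc i) G.≈ b)) →
               (∀ i → ¬ (at (suc i) G.≈ a × at (inject₁ i) G.≈ b)) →
               Conn (deleteArc G a b) (at zero) (at last)
      around n₁ n₂ = along at λ i → EqC.symmetric _ (convert i (step i))
        where
        convert : ∀ i → Adj G (at (inject₁ i)) (at (suc i)) →
                  Conn (deleteArc G _ _) (at (suc i)) (at (inject₁ i))
        convert i (fwd e) = conn-sym (deleteArc G _ _) (conn-⇒ (deleteArc G _ _) (e , n₁ i))
        convert i (bwd e) = conn-⇒ (deleteArc G _ _) (e , n₂ i)

      not-close : ∀ i → at (inject₁ i) G.≈ at zero → ¬ at (suc i) G.≈ at last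
      not-close zero    _ q with injective q
      ... | ()
      not-close (suc i) p _ with injective p
      ... | ()

      not-zero : ∀ i → ¬ at (suc i) G.≈ at zero
      not-zero i p with injective p
      ... | ()

    -- The remaining steps of the cycle bypass its closing edge. None of them is that edge again, by
    -- injectivity and because there are at least three vertices.
    bridged⇒acyclic : ⊥
    bridged⇒acyclic with close
    ... | fwd e = bridged e (conn-sym (deleteArc G _ _) (around
                    (λ i (_ , q) → not-zero i q) (λ i (p , q) → not-close i q p)))
    ... | bwd e = bridged e (around
                    (λ i (p , q) → not-close i p q) (λ i (p , _) → not-zero i p))

-- Trees as rooted trees

module Cut {T : Digraph} (tree : IsTree T) {a b : V T} (a⇒b : T [ a ⇒ b ]) where

  private
    module T = Digraph T
    T′ = deleteArc T a b

  open IsTree tree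

  separate : ¬ Conn T′ a b
  separate = tree⇒bridged tree a⇒b

  module Side (s : V T) = Induced T (conn-resp T′ {s}) (conn? T′ s)

  module A = Side a
  module B = Side b

  -- Along a walk from `a`, only the arc `(a , b)` can change the side, and its ends are the base
  -- points of the two sides.
  cover : ∀ v → Conn T′ a v ⊎ Conn T′ b v
  cover v = conn-induction T step (connected a v) (inj₁ ε)
    where
    Sides : V T → Set
    Sides v = Conn T′ a v ⊎ Conn T′ b v

    move : ∀ {u v} → Conn T′ u v → Sides u → Sides v
    move c (inj₁ d) = inj₁ (d ◅◅ c)
    move c (inj₂ d) = inj₂ (d ◅◅ c)

    step : ∀ {u v} → SymClosure (Step T) u v → Sides u → Sides v
    step (fwd (inj₁ eq)) s = move (conn-≈ T′ eq) s
    step (bwd (inj₁ eq)) s = move (conn-≈ T′ (T.sym eq)) s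
    step {u} {v} (fwd (inj₂ e)) s with (u T.≟ a) ×-dec (v T.≟ b)
    ... | yes (_ , v≈b) = inj₂ (conn-≈ T′ (T.sym v≈b))
    ... | no n          = move (conn-⇒ T′ (e , n)) s
    step {u} {v} (bwd (inj₂ e)) s with (v T.≟ a) ×-dec (u T.≟ b)
    ... | yes (v≈a , _) = inj₁ (conn-≈ T′ (T.sym v≈a))
    ... | no n          = move (conn-sym T′ (conn-⇒ T′ (e , n))) s

  disjoint : ∀ {v} → Conn T′ a v → Conn T′ b v → ⊥
  disjoint c d = separate (c ◅◅ conn-sym T′ d)

  -- A walk of `T′` from `s` never leaves the side of `s`, so `lift` turns it into a walk of the
  -- induced digraph.
  side-tree : ∀ s → IsTree (Side.digraph s)
  side-tree s = record
    { nonempty   = s , ε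
    ; asymmetric = asymmetric
    ; connected  = λ (u , c) (v , d) → conn-sym S (lift ε c c) ◅◅ lift ε d d
    ; acyclic    = λ c → acyclic record
        { k         = Cycle.k c
        ; at        = proj₁ ∘ Cycle.at c
        ; injective = Cycle.injective c
        ; step      = λ i → SymC.gmap proj₁ id (Cycle.step c i)
        ; close     = SymC.gmap proj₁ id (Cycle.close c)
        }
    }
    where
    S = Side.digraph s

    lift-step : ∀ {u v p q} → SymClosure (Step T′) u v → SymClosure (Step S) (u , p) (v , q)
    lift-step (fwd (inj₁ eq))      = fwd (inj₁ eq)
    lift-step (fwd (inj₂ (e , _))) = fwd (inj₂ e)
    lift-step (bwd (inj₁ eq))      = bwd (inj₁ eq)
    lift-step (bwd (inj₂ (e , _))) = bwd (inj₂ e)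

    lift : ∀ {u v} (p : Conn T′ s u) (q : Conn T′ s v) → Conn T′ u v → Conn S (u , p) (v , q)
    lift p q ε       = conn-≈ S T.refl
    lift p q (e ◅ c) = lift-step e ◅ lift (p ◅◅ (e ◅ ε)) q c

  cross : ∀ {u v} → Conn T′ a u → Conn T′ b v → T [ u ⇒ v ] → u T.≈ a × v T.≈ b
  cross {u} {v} c d e with (u T.≟ a) ×-dec (v T.≟ b)
  ... | yes eqs = eqs
  ... | no n    = ⊥-elim (disjoint (c ◅◅ conn-⇒ T′ (e , n)) d)

  no-cross : ∀ {u v} → Conn T′ b u → Conn T′ a v → ¬ T [ u ⇒ v ]
  no-cross d c e = disjoint c
    (d ◅◅ conn-⇒ T′ (e , λ (u≈a , _) → disjoint (conn-≈ T′ (T.sym u≈a)) d))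

  module _ {G : Digraph} (f : Hom A.digraph G) (g : Hom B.digraph G)
           (bridge : G [ to f (a , ε) ⇒ to g (b , ε) ]) where

    private
      open Glue {T} {G} (conn-resp T′ {a}) (conn? T′ a) (conn-resp T′ {b}) (conn? T′ b)
                cover disjoint

      f⇒g : ∀ {u v} (c : Conn T′ a u) (d : Conn T′ b v) → T [ u ⇒ v ] →
            G [ to f (u , c) ⇒ to g (v , d) ]
      f⇒g c d e with cross c d e
      ... | u≈a , v≈b = Digraph.⇒-resp G (cong f (T.sym u≈a)) (cong g (T.sym v≈b)) bridge

      g⇒f : ∀ {u v} (d : Conn T′ b u) (c : Conn T′ a v) → T [ u ⇒ v ] →
            G [ to g (u , d) ⇒ to f (v , c) ]
      g⇒f d c e = ⊥-elim (no-cross d c e)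

    -- By `cross` and `no-cross`, `(a , b)` is the only arc between the sides, so `bridge` is all
    -- that has to be compatible. Both base points are tracked, as either may be the root.
    rejoin : ∃ λ (h : Hom T G) →
             G [ to h a ≈ to f (a , ε) ] × G [ to h b ≈ to g (b , ε) ]
    rejoin = glue f g f⇒g g⇒f , glue-p f g f⇒g g⇒f ε , glue-q f g f⇒g g⇒f ε

-- Whether the edge from a node to its child points away from the root
-- (down) or towards it (up).
data Direction : Set where
  down up : Direction

-- join t d s hangs the root of s, as one more child, on the root of t.
data RootedTree : Set where
  leaf : RootedTree
  join : RootedTree → Direction → RootedTree → RootedTree

module _ (G : Digraph) where

  private
    module G = Digraph G

  Neighbour : Direction → Rel (V G) 0ℓ
  Neighbour down x y = G [ x ⇒ y ]
  Neighbour up   x y = G [ y ⇒ x ]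

  -- The rooted tree admits a homomorphism to G sending its root to x.
  Fits : RootedTree → V G → Set
  Fits leaf         _ = ⊤
  Fits (join t d s) x = Fits t x × ∃ λ y → Neighbour d x y × Fits s y

  neighbour-resp : ∀ d {x x′ y y′} → x G.≈ x′ → y G.≈ y′ → Neighbour d x y → Neighbour d x′ y′
  neighbour-resp down p q = G.⇒-resp p q
  neighbour-resp up   p q = G.⇒-resp q p

  neighbour? : ∀ d → Decidable (Neighbour d)
  neighbour? down x y = x G.⇒? y
  neighbour? up   x y = y G.⇒? x

  fits-resp : ∀ t {x y} → x G.≈ y → Fits t x → Fits t y
  fits-resp leaf         _   _               = tt
  fits-resp (join t d s) x≈y (p , z , e , q) =
    fits-resp t x≈y p , z , neighbour-resp d x≈y G.refl e , q

  mutual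

    fits? : ∀ t x → Dec (Fits t x)
    fits? leaf         x = yes tt
    fits? (join t d s) x = fits? t x ×-dec child? d s x

    child? : ∀ d s x → Dec (∃ λ y → Neighbour d x y × Fits s y)
    child? d s x = ∃? G.setoid (enumerates G)
      (λ y≈z (e , p) → neighbour-resp d G.refl y≈z e , fits-resp s y≈z p)
      (λ y → neighbour? d x y ×-dec fits? s y)

neighbour-map : (f : Hom G H) → ∀ d {x y} → Neighbour G d x y → Neighbour H d (to f x) (to f y)
neighbour-map f down = preserve f
neighbour-map f up   = preserve f

fits-map : (f : Hom G H) → ∀ t {x} → Fits G t x → Fits H t (to f x)
fits-map f leaf         _               = tt
fits-map f (join t d s) (p , y , e , q) =
  fits-map f t p , to f y , neighbour-map f d e , fits-map f s q

-- By `fits-map` and `fits-resp`, the first component yields the converse of the second: `t` fits at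
-- `x` exactly when some homomorphism sends `r` to `x`.
Represents : (t : RootedTree) (T : Digraph) → V T → Set₁
Represents t T r = Fits T t r ×
  (∀ G x → Fits G t x → ∃ λ (f : Hom T G) → G [ to f r ≈ x ])

-- Deleting an arc at the root leaves two smaller trees, and the one without the root becomes a
-- further child. If there is no such arc, connectedness makes the root the only vertex.
represent : ∀ n {T} → length (enum T) < n → IsTree T → ∀ r → ∃ λ t → Represents t T r
represent (suc n) {T} (s≤s size≤n) tree r
  with ∃? T.setoid (enumerates T) (λ p → T.⇒-resp T.refl p) (λ c → r T.⇒? c)
     | ∃? T.setoid (enumerates T) (λ p → T.⇒-resp p T.refl) (λ c → c T.⇒? r)
  where module T = Digraph T
... | yes (c , r⇒c) | _ = join (proj₁ ih₁) down (proj₁ ih₂) ,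
        (fits-map A.inclusion (proj₁ ih₁) (proj₁ (proj₂ ih₁)) , c , r⇒c ,
         fits-map B.inclusion (proj₁ ih₂) (proj₁ (proj₂ ih₂))) ,
        λ G x (p , y , x⇒y , q) →
          let module G = Digraph G
              f , fr≈x = proj₂ (proj₂ ih₁) G x p
              g , gc≈y = proj₂ (proj₂ ih₂) G y q
              h , hr≈ , _ = rejoin f g (G.⇒-resp (G.sym fr≈x) (G.sym gc≈y) x⇒y)
          in h , G.trans hr≈ fr≈x
  where
  open Cut tree r⇒c
  ih₁ = represent n (<-≤-trans (A.smaller separate) size≤n) (side-tree r) (r , ε)
  ih₂ = represent n (<-≤-trans (B.smaller (separate ∘ conn-sym (deleteArc T r c))) size≤n)
                  (side-tree c) (c , ε)
-- The arc now enters the root, so the root lies on the side `B` of the cut.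
... | no _ | yes (c , c⇒r) = join (proj₁ ih₂) up (proj₁ ih₁) ,
        (fits-map B.inclusion (proj₁ ih₂) (proj₁ (proj₂ ih₂)) , c , c⇒r ,
         fits-map A.inclusion (proj₁ ih₁) (proj₁ (proj₂ ih₁))) ,
        λ G x (p , y , y⇒x , q) →
          let module G = Digraph G
              f , fc≈y = proj₂ (proj₂ ih₁) G y q
              g , gr≈x = proj₂ (proj₂ ih₂) G x p
              h , _ , hr≈ = rejoin f g (G.⇒-resp (G.sym fc≈y) (G.sym gr≈x) y⇒x)
          in h , G.trans hr≈ gr≈x
  where
  open Cut tree c⇒r
  ih₁ = represent n (<-≤-trans (A.smaller separate) size≤n) (side-tree c) (c , ε)
  ih₂ = represent n (<-≤-trans (B.smaller (separate ∘ conn-sym (deleteArc T c r))) size≤n)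
                  (side-tree r) (r , ε)
... | no no-out | no no-in = leaf , tt , λ G x _ → record
        { to       = λ _ → x
        ; cong     = λ _ → Digraph.refl G
        ; preserve = λ {u} {v} u⇒v → ⊥-elim (no-out (v , T.⇒-resp (T.sym (only u)) T.refl u⇒v))
        } , Digraph.refl G
  where
  module T = Digraph T

  step : ∀ {u v} → SymClosure (Step T) u v → r T.≈ u → r T.≈ v
  step (fwd (inj₁ eq)) p = T.trans p eq
  step (bwd (inj₁ eq)) p = T.trans p (T.sym eq)
  step (fwd (inj₂ e))  p = ⊥-elim (no-out (_ , T.⇒-resp (T.sym p) T.refl e))
  step (bwd (inj₂ e))  p = ⊥-elim (no-in (_ , T.⇒-resp T.refl (T.sym p) e))

  only : ∀ v → r T.≈ v
  only v = conn-induction T step (IsTree.connected tree r v) T.refl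

-- The dual of a rooted tree

-- The Boolean of a `join` claims that some neighbour in its direction admits the subtree `s`; the
-- labels nested in `t` and `s` hold the claims for the other nodes.
Labelling : RootedTree → Set
Labelling leaf         = ⊤
Labelling (join t _ s) = Labelling t × Bool × Labelling s

-- Only the children of the root count, since the claim for a child speaks of its whole subtree.
Satisfied : ∀ t → Labelling t → Set
Satisfied leaf         _           = ⊤
Satisfied (join t _ _) (l , b , _) = Satisfied t l × Bool.T b

satisfied? : ∀ t → U.Decidable (Satisfied t)
satisfied? leaf         _           = yes tt
satisfied? (join t _ _) (l , b , _) = satisfied? t l ×-dec T? b

-- An arc whose far end satisfies `s` forces the claim at the near end. A claim may also be true
-- without such a witness.
Propagates : ∀ t → Rel (Labelling t) 0ℓ
Propagates leaf            _           _              = ⊤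
Propagates (join t down s) (l , b , m) (l′ , b′ , m′) =
  Propagates t l l′ × (Satisfied s m′ → Bool.T b) × Propagates s m m′
Propagates (join t up s)   (l , b , m) (l′ , b′ , m′) =
  Propagates t l l′ × (Satisfied s m → Bool.T b′) × Propagates s m m′

propagates? : ∀ t → Decidable (Propagates t)
propagates? leaf            _           _              = yes tt
propagates? (join t down s) (l , b , m) (l′ , b′ , m′) =
  propagates? t l l′ ×-dec ((satisfied? s m′ →-dec T? b) ×-dec propagates? s m m′)
propagates? (join t up s)   (l , b , m) (l′ , b′ , m′) =
  propagates? t l l′ ×-dec ((satisfied? s m →-dec T? b′) ×-dec propagates? s m m′)

_≟ˡ_ : ∀ {t} → Decidable (_≡_ {A = Labelling t})
_≟ˡ_ {leaf}       _ _ = yes ≡.refl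
_≟ˡ_ {join t _ s}     = ≡-dec (_≟ˡ_ {t}) (≡-dec Boolₚ._≟_ (_≟ˡ_ {s}))

labellings : ∀ t → List (Labelling t)
labellings leaf         = tt ∷ []
labellings (join t _ s) =
  cartesianProduct (labellings t) (cartesianProduct (false ∷ true ∷ []) (labellings s))

∈-labellings : ∀ t l → l ∈ labellings t
∈-labellings leaf         _           = here ≡.refl
∈-labellings (join t _ s) (l , b , m) =
  ∈-cartesianProduct⁺ (∈-labellings t l) (∈-cartesianProduct⁺ (∈-bools b) (∈-labellings s m))
  where
  ∈-bools : ∀ b → b ∈ (false ∷ true ∷ [])
  ∈-bools false = here ≡.refl
  ∈-bools true  = there (here ≡.refl)

labelDigraph : RootedTree → Digraph
labelDigraph t = record
  { vertices   = ≡ₚ.decSetoid (_≟ˡ_ {t})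
  ; enum       = labellings t
  ; enumerates = ∈-labellings t
  ; _⇒ᵍ_       = Propagates t
  ; ⇒-resp-≈   = (λ { ≡.refl e → e }) , (λ { ≡.refl e → e })
  ; _⇒?_       = propagates? t
  }

Unsatisfied : ∀ t → Labelling t → Set
Unsatisfied t l = ¬ Satisfied t l

module Dual (t : RootedTree) = Induced (labelDigraph t)
  (≡.subst (Unsatisfied t)) (λ l → ¬? (satisfied? t l))

-- Claims are forced from the leaves upwards: the labels of `t` and of `s` alone are again
-- homomorphisms, and the edge `e` then forces the Boolean between them.
fits⇒satisfied : ∀ t (ℓ : Hom G (labelDigraph t)) {x} → Fits G t x → Satisfied t (to ℓ x)
fits⇒satisfied leaf ℓ _ = tt
fits⇒satisfied {G} (join t d s) ℓ {x} (p , y , e , q) =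
  fits⇒satisfied t ℓ₁ p , child d ℓ e (fits⇒satisfied s ℓ₂ q)
  where
  split : ∀ d {l b m l′ b′ m′} → Propagates (join t d s) (l , b , m) (l′ , b′ , m′) →
          Propagates t l l′ × Propagates s m m′
  split down (p , _ , q) = p , q
  split up   (p , _ , q) = p , q

  ℓ₁ : Hom G (labelDigraph t)
  ℓ₁ = record { to       = proj₁ ∘ to ℓ
              ; cong     = ≡.cong proj₁ ∘ cong ℓ
              ; preserve = proj₁ ∘ split d ∘ preserve ℓ }

  ℓ₂ : Hom G (labelDigraph s)
  ℓ₂ = record { to       = proj₂ ∘ proj₂ ∘ to ℓ
              ; cong     = ≡.cong (proj₂ ∘ proj₂) ∘ cong ℓ
              ; preserve = proj₂ ∘ split d ∘ preserve ℓ }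

  child : ∀ d (ℓ : Hom G (labelDigraph (join t d s))) {x y} → Neighbour G d x y →
          Satisfied s (proj₂ (proj₂ (to ℓ y))) → Bool.T (proj₁ (proj₂ (to ℓ x)))
  child down ℓ e = proj₁ (proj₂ (preserve ℓ e))
  child up   ℓ e = proj₁ (proj₂ (preserve ℓ e))

module _ (G : Digraph) where

  private
    module G = Digraph G

  label : ∀ t → V G → Labelling t
  label leaf         _ = tt
  label (join t d s) x = label t x , isYes (child? G d s x) , label s x

  label-cong : ∀ t {x y} → x G.≈ y → label t x ≡ label t y
  label-cong leaf         _   = ≡.refl
  label-cong (join t d s) {x} {y} x≈y = ≡.cong₂ _,_ (label-cong t x≈y) (≡.cong₂ _,_
    (≡.trans (isYes≗does (child? G d s x)) (≡.trans (does-⇔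
      (mk⇔ (λ (z , e , p) → z , neighbour-resp G d x≈y G.refl e , p)
           (λ (z , e , p) → z , neighbour-resp G d (G.sym x≈y) G.refl e , p))
      (child? G d s x) (child? G d s y)) (≡.sym (isYes≗does (child? G d s y)))))
    (label-cong s x≈y))

  satisfied⇒fits : ∀ t {x} → Satisfied t (label t x) → Fits G t x
  satisfied⇒fits leaf         _       = tt
  satisfied⇒fits (join t d s) (p , b) = satisfied⇒fits t p , toWitness b

  -- Under the labelling by true claims a satisfied label gives an actual fit, so the arc itself
  -- witnesses the claim.
  label-preserve : ∀ t {x y} → G [ x ⇒ y ] → Propagates t (label t x) (label t y)
  label-preserve leaf            e = tt
  label-preserve (join t down s) e =
    label-preserve t e , (λ p → fromWitness (_ , e , satisfied⇒fits s p)) , label-preserve s e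
  label-preserve (join t up s)   e =
    label-preserve t e , (λ p → fromWitness (_ , e , satisfied⇒fits s p)) , label-preserve s e

  fits⊎dual : ∀ t → ∃ (Fits G t) ⊎ Hom G (Dual.digraph t)
  fits⊎dual t with ∃? G.setoid (enumerates G) (fits-resp G t) (fits? G t)
  ... | yes p = inj₁ p
  ... | no n  = inj₂ record
    { to       = λ x → label t x , λ p → n (x , satisfied⇒fits t p)
    ; cong     = label-cong t
    ; preserve = label-preserve t
    }

fits⇒¬dual : ∀ t {x} → Fits G t x → ¬ Hom G (Dual.digraph t)
fits⇒¬dual t {x} p f = proj₂ (to f x) (fits⇒satisfied t (Dual.inclusion t ∘ʰ f) p)

-- Digraphs with a dual

-- Homomorphisms `F → G` and `G → D` would compose to `F → D`; excluding this one makes the two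
-- alternatives exclusive for every `G`.
HasDual : Digraph → Set₁
HasDual F = ∃ λ D → ¬ Hom F D × (∀ G → Hom F G ⊎ Hom G D)

hasDual-resp : HomEquivalent F G → HasDual F → HasDual G
hasDual-resp (f , g) (D , F↛D , dual) =
  D , (λ h → F↛D (h ∘ʰ f)) , λ H → Sum.map₁ (_∘ʰ g) (dual H)

homEquivalent-trans : HomEquivalent F G → HomEquivalent G H → HomEquivalent F H
homEquivalent-trans (f , f′) (g , g′) = g ∘ʰ f , f′ ∘ʰ g′

-- Cores and their endomorphisms.

Core : Digraph → Set
Core F = ∀ (φ : Hom F F) v → ∃ λ u → F [ to φ u ≈ v ]

module _ (F : Digraph) where

  private
    module F = Digraph F

  hit? : (φ : Hom F F) → U.Decidable (λ v → ∃ λ u → to φ u F.≈ v)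
  hit? φ v = ∃? F.setoid (enumerates F)
    (λ u≈u′ p → F.trans (cong φ (F.sym u≈u′)) p) (λ u → to φ u F.≟ v)

  core⊎shrink : Core F ⊎ (∃ λ (φ : Hom F F) → ∃ λ v → ¬ (∃ λ u → to φ u F.≈ v))
  core⊎shrink with ∃? (HomSet.setoid F F) (HomSet.homs-enumerates F F)
    (λ φ≈χ (v , n) → v , λ (u , p) → n (u , F.trans (φ≈χ u) p))
    (λ φ → ∃? F.setoid (enumerates F)
      (λ v≈w n (u , p) → n (u , F.trans p (F.sym v≈w))) (λ v → ¬? (hit? φ v)))
  ... | yes shrink = inj₂ shrink
  ... | no n       = inj₁ λ φ v → surjective φ v (hit? φ v)
    where
    surjective : ∀ φ v → Dec (∃ λ u → to φ u F.≈ v) → ∃ λ u → to φ u F.≈ v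
    surjective φ v (yes p) = p
    surjective φ v (no m)  = ⊥-elim (n (φ , v , m))

  module Image (φ : Hom F F) = Induced F {λ v → ∃ λ u → to φ u F.≈ v}
    (λ v≈w (u , p) → u , F.trans p v≈w) (hit? φ)

  image-equivalent : ∀ φ → HomEquivalent F (Image.digraph φ)
  image-equivalent φ = record
    { to       = λ u → to φ u , u , F.refl
    ; cong     = cong φ
    ; preserve = preserve φ
    } , Image.inclusion φ

  infixr 10 _^ʰ_

  _^ʰ_ : Hom F F → ℕ → Hom F F
  φ ^ʰ zero  = idʰ
  φ ^ʰ suc n = φ ∘ʰ φ ^ʰ n

  ^ʰ-+ : ∀ φ m n x → to (φ ^ʰ (m + n)) x ≡ to (φ ^ʰ m) (to (φ ^ʰ n) x)
  ^ʰ-+ φ zero    n x = ≡.refl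
  ^ʰ-+ φ (suc m) n x = ≡.cong (to φ) (^ʰ-+ φ m n x)

  reflexive : ∀ {u v} → u ≡ v → u F.≈ v
  reflexive ≡.refl = F.refl

  -- Two powers of `φ` with exponents `i < j` agree. The `i`-th power is surjective, hence can be
  -- cancelled, which leaves the exponent `j - i = 1 + n`.
  core⇒periodic : Core F → ∀ φ → ∃ λ n → φ ^ʰ suc n ≗ʰ idʰ
  core⇒periodic core φ =
    period (pigeonhole (HomSet.setoid F F) (HomSet.homs-enumerates F F) (λ i → φ ^ʰ toℕ i))
    where
    period : ∀ {m} → (∃₂ λ (i j : Fin m) → i Fin.< j × φ ^ʰ toℕ i ≗ʰ φ ^ʰ toℕ j) →
             ∃ λ n → φ ^ʰ suc n ≗ʰ idʰ
    period (i , j , i<j , φⁱ≈φʲ) with m≤n⇒∃[o]m+o≡n i<j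
    ... | n , eq = n , λ x →
      let y , φⁱy≈x = core (φ ^ʰ toℕ i) x
          φ¹⁺ⁿφⁱ≡φʲ = ≡.trans (≡.sym (^ʰ-+ φ (suc n) (toℕ i) y))
            (≡.cong (λ k → to (φ ^ʰ k) y) (≡.trans (≡.cong suc (+-comm n (toℕ i))) eq))
      in F.trans (cong (φ ^ʰ suc n) (F.sym φⁱy≈x))
           (F.trans (reflexive φ¹⁺ⁿφⁱ≡φʲ) (F.trans (F.sym (φⁱ≈φʲ y)) φⁱy≈x))

-- Cores with a dual are trees.

module Blowup (F : Digraph) (a b : V F) (N : ℕ) where

  private
    module F = Digraph F
    F′ = deleteArc F a b

  Ascends : Rel (Fin N × V F) 0ℓ
  Ascends (i , u) (j , v) = i Fin.< j × u F.≈ a × v F.≈ b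

  digraph : Digraph
  digraph = record
    { vertices   = ×-decSetoid (≡ₚ.decSetoid Finₚ._≟_) F.vertices
    ; enum       = cartesianProduct (allFin N) (enum F)
    ; enumerates = Enumₚ.cartesianProduct⁺ (≡ₚ.setoid (Fin N)) F.setoid ∈-allFin (enumerates F)
    ; _⇒ᵍ_       = λ (i , u) (j , v) → (i ≡ j × F′ [ u ⇒ v ]) ⊎ Ascends (i , u) (j , v)
    ; ⇒-resp-≈   =
        (λ { (≡.refl , v≈w) (inj₁ (eq , e))    → inj₁ (eq , Digraph.⇒-resp F′ F.refl v≈w e)
           ; (≡.refl , v≈w) (inj₂ (lt , p , q)) → inj₂ (lt , p , F.trans (F.sym v≈w) q) }) ,
        (λ { (≡.refl , v≈w) (inj₁ (eq , e))    → inj₁ (eq , Digraph.⇒-resp F′ v≈w F.refl e)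
           ; (≡.refl , v≈w) (inj₂ (lt , p , q)) → inj₂ (lt , F.trans (F.sym v≈w) p , q) })
    ; _⇒?_       = λ (i , u) (j , v) →
        ((i Finₚ.≟ j) ×-dec Digraph._⇒?_ F′ u v) ⊎-dec
        ((i Finₚ.<? j) ×-dec ((u F.≟ a) ×-dec (v F.≟ b)))
    }

  projection : F [ a ⇒ b ] → Hom digraph F
  projection a⇒b = record
    { to       = proj₂
    ; cong     = proj₂
    ; preserve = λ { (inj₁ (_ , e , _))      → e
                   ; (inj₂ (_ , u≈a , v≈b)) → F.⇒-resp (F.sym u≈a) (F.sym v≈b) a⇒b }
    }

  layer : ∀ {D} → Hom digraph D → Fin N → Hom F′ D
  layer f i = record
    { to       = λ v → to f (i , v)
    ; cong     = λ u≈v → cong f (≡.refl , u≈v)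
    ; preserve = λ e → preserve f (inj₁ (≡.refl , e))
    }

  -- `layer f i` preserves all arcs but the deleted one. For that one the arc from `a` in layer `i`
  -- to `b` in layer `j` steps in, since both layers colour `b` alike.
  merge : ∀ {D} (f : Hom digraph D) {i j} → i Fin.< j → layer f i ≗ʰ layer f j → Hom F D
  merge {D} f {i} {j} i<j fᵢ≈fⱼ = record
    { to       = to (layer f i)
    ; cong     = cong (layer f i)
    ; preserve = preserve′
    }
    where
    preserve′ : ∀ {u v} → F [ u ⇒ v ] → D [ to f (i , u) ⇒ to f (i , v) ]
    preserve′ {u} {v} e with (u F.≟ a) ×-dec (v F.≟ b)
    ... | yes (u≈a , v≈b) = Digraph.⇒-resp D (Digraph.refl D) (Digraph.sym D (fᵢ≈fⱼ v))
                              (preserve f (inj₂ (i<j , u≈a , v≈b)))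
    ... | no n            = preserve (layer f i) (e , n)

  -- Only ascending arcs change the layer, and a section uses them for `(a , b)` alone. So the layer
  -- is constant on components of `F′`, yet it increases from `a` to `b`.
  section⇒separate : F [ a ⇒ b ] → (ψ : Hom F digraph) → (∀ v → proj₂ (to ψ v) F.≈ v) →
                     ¬ Conn F′ a b
  section⇒separate a⇒b ψ section c with preserve ψ a⇒b
  ... | inj₁ (_ , _ , n)   = n (section a , section b)
  ... | inj₂ (h[a]<h[b] , _) = Finₚ.<-irrefl (constant c) h[a]<h[b]
    where
    constant-⇒ : ∀ {u v} → F′ [ u ⇒ v ] → proj₁ (to ψ u) ≡ proj₁ (to ψ v)
    constant-⇒ (e , n) with preserve ψ e
    ... | inj₁ (eq , _)      = eq
    ... | inj₂ (_ , p , q) =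
      ⊥-elim (n (F.trans (F.sym (section _)) p , F.trans (F.sym (section _)) q))

    constant : ∀ {u v} → Conn F′ u v → proj₁ (to ψ u) ≡ proj₁ (to ψ v)
    constant = EqC.gfold ≡ₚ.isEquivalence (proj₁ ∘ to ψ)
      [ proj₁ ∘ cong ψ , constant-⇒ ]

core⇒bridged : Core F → HasDual F → Bridged F
core⇒bridged {F} core (D , F↛D , dual) {a} {b} a⇒b = separate (dual digraph)
  where
  -- One layer more than the listed homomorphisms of the layers to `D`, so that two layers must be
  -- coloured alike.
  open Blowup F a b (suc (length (HomSet.homs (deleteArc F a b) D)))

  separate : Hom F digraph ⊎ Hom digraph D → ¬ Conn (deleteArc F a b) a b
  separate (inj₁ ψ) =
    -- With `φ` the projection after `ψ`, precomposing `ψ` with the `n`-th power of `φ` gives a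
    -- section.
    let n , φ¹⁺ⁿ≈id = core⇒periodic F core (projection a⇒b ∘ʰ ψ)
    in section⇒separate a⇒b (ψ ∘ʰ _^ʰ_ F (projection a⇒b ∘ʰ ψ) n) φ¹⁺ⁿ≈id
  separate (inj₂ f) _ = F↛D (recolour
    (pigeonhole (HomSet.setoid (deleteArc F a b) D)
                (HomSet.homs-enumerates (deleteArc F a b) D) (layer f)))
    where
    recolour : (∃₂ λ i j → i Fin.< j × layer f i ≗ʰ layer f j) → Hom F D
    recolour (i , j , i<j , fᵢ≈fⱼ) = merge f i<j fᵢ≈fⱼ

core⇒connected : Core F → HasDual F → ∀ u v → Conn F u v
core⇒connected {F} core (D , F↛D , dual) u v with conn? F u v
... | yes c = c
... | no ¬c = ⊥-elim (F↛D (glue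
  (avoid C.digraph C.inclusion v λ x eq → ¬c (resp eq (proj₂ x)))
  (avoid N.digraph N.inclusion u λ x eq → proj₂ x (conn-≈ F (F.sym eq)))
  (λ c n e → ⊥-elim (n (c ◅◅ conn-⇒ F e)))
  (λ n c e → ⊥-elim (n (c ◅◅ conn-sym F (conn-⇒ F e))))))
  where
  module F = Digraph F

  resp : Conn F u Respects F._≈_
  resp = conn-resp F {u}

  ¬resp : (λ w → ¬ Conn F u w) Respects F._≈_
  ¬resp eq n c = n (resp (F.sym eq) c)

  module C = Induced F resp (conn? F u)
  module N = Induced F ¬resp (λ w → ¬? (conn? F u w))

  decide : ∀ w → Conn F u w ⊎ ¬ Conn F u w
  decide w with conn? F u w
  ... | yes c = inj₁ c
  ... | no n  = inj₂ n

  open Glue {F} {D} resp (conn? F u) ¬resp (λ w → ¬? (conn? F u w)) decide (λ c n → n c)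

  -- A homomorphism `F → G` followed by `ι` would be an endomorphism of the core that misses `w`;
  -- hence the dual gives `G → D`.
  avoid : ∀ G (ι : Hom G F) w → (∀ x → ¬ to ι x F.≈ w) → Hom G D
  avoid G ι w miss with dual G
  ... | inj₁ f = ⊥-elim (miss _ (proj₂ (core (ι ∘ʰ f) w)))
  ... | inj₂ g = g

hasDual⇒nonempty : HasDual F → V F
hasDual⇒nonempty {F} (D , F↛D , _) with enum F | enumerates F
... | v ∷ _ | _     = v
... | []    | every = ⊥-elim (F↛D record
  { to       = λ v → absurd (every v)
  ; cong     = λ {u} _ → absurd (every u)
  ; preserve = λ {u} _ → absurd (every u)
  })
  where
  absurd : {A B : Set} {P : Pred A 0ℓ} → Any P [] → B
  absurd ()

core⇒tree : Core F → HasDual F → IsTree F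
core⇒tree {F} core dual = record
  { nonempty   = hasDual⇒nonempty dual
  ; asymmetric = bridged⇒asymmetric {F} bridged
  ; connected  = core⇒connected core dual
  ; acyclic    = bridged⇒acyclic {F} bridged
  }
  where bridged = core⇒bridged core dual

-- While some endomorphism is not surjective, `F` is replaced by its image, which is smaller,
-- equivalent and so still has a dual.
hasDual⇒equivalentToTree : HasDual F → EquivalentToTree F
hasDual⇒equivalentToTree {F} = shrink (suc (length (enum F))) ≤-refl
  where
  shrink : ∀ n {F} → length (enum F) < n → HasDual F → EquivalentToTree F
  shrink (suc n) {F} (s≤s size≤n) dual with core⊎shrink F
  ... | inj₁ core         = F , core⇒tree core dual , idʰ , idʰ
  ... | inj₂ (φ , _ , ¬hit)
    with shrink n (<-≤-trans (Image.smaller F φ ¬hit) size≤n)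
                (hasDual-resp (image-equivalent F φ) dual)
  ... | T , tree , equiv = T , tree , homEquivalent-trans (image-equivalent F φ) equiv

-- Adjunction of the Pultr functors

module _ {A : Set} where

  first : {P : Pred A 0ℓ} → U.Decidable P → (xs : List A) → Any P xs → ∃ P
  first P? (x ∷ xs) p with P? x
  first P? (x ∷ xs) p         | yes px = x , px
  first P? (x ∷ xs) (here px) | no ¬px = ⊥-elim (¬px px)
  first P? (x ∷ xs) (there p) | no _   = first P? xs p

  -- The search stops at the first element satisfying the predicate, whichever `Any` proof
  -- guarantees that one exists.
  first-cong : {P Q : Pred A 0ℓ} (P? : U.Decidable P) (Q? : U.Decidable Q) →
               (∀ {x} → P x → Q x) → (∀ {x} → Q x → P x) → ∀ {xs} p q →
               proj₁ (first P? xs p) ≡ proj₁ (first Q? xs q)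
  first-cong P? Q? P⊆Q Q⊆P {x ∷ xs} p q with P? x | Q? x
  ... | yes _  | yes _  = ≡.refl
  ... | yes px | no ¬qx = ⊥-elim (¬qx (P⊆Q px))
  ... | no ¬px | yes qx = ⊥-elim (¬px (Q⊆P qx))
  first-cong P? Q? P⊆Q Q⊆P (here px) _         | no ¬px | no _   = ⊥-elim (¬px px)
  first-cong P? Q? P⊆Q Q⊆P (there _) (here qx) | no _   | no ¬qx = ⊥-elim (¬qx qx)
  first-cong P? Q? P⊆Q Q⊆P (there p) (there q) | no _   | no _   = first-cong P? Q? P⊆Q Q⊆P p q

module _ (𝒯 : PultrTemplate) where

  open PultrTemplate 𝒯

  private
    Γ Λ : Digraph → Digraph
    Γ = centralObj 𝒯
    Λ = LeftPultr.leftObj 𝒯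

  unit : ∀ G → Hom G (Γ (Λ G))
  unit G = record
    { to       = λ u → record
      { to       = λ x → inj₁ (u , x)
      ; cong     = λ p → EqC.return (same (inj₁ (G.refl , p)))
      ; preserve = λ e → imageP u e ε ε
      }
    ; cong     = λ u≈v x → EqC.return (same (inj₁ (u≈v , Digraph.refl P)))
    ; preserve = λ e → record
      { to       = λ x → inj₂ (ArcSet.arc e , x)
      ; cong     = λ p → EqC.return (same (inj₂ ((G.refl , G.refl) , p)))
      ; preserve = λ f → imageQ (ArcSet.arc e) f ε ε
      } , (λ x → EqC.return (glue₁ (ArcSet.arc e) x)) , (λ x → EqC.return (glue₂ (ArcSet.arc e) x))
    }
    where
    module G = Digraph G
    open LeftPultr 𝒯 G

  module _ {G H : Digraph} (f : Hom G (Γ H)) where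

    private
      module G = Digraph G
      module H = Digraph H
      open LeftPultr 𝒯 G
      open ArcSet G using (Arc; source; target; isArc)

      Extends : Arc → Pred (Hom Q H) 0ℓ
      Extends a h = to f (source a) ≗ʰ h ∘ʰ ε₁ × to f (target a) ≗ʰ h ∘ʰ ε₂

      extends-resp : ∀ a {g h} → g ≗ʰ h → Extends a g → Extends a h
      extends-resp a g≈h (p , q) =
        (λ x → H.trans (p x) (g≈h (to ε₁ x))) , (λ x → H.trans (q x) (g≈h (to ε₂ x)))

      extends-cong : ∀ {a b} → ArcSet._≈_ G a b → ∀ {h} → Extends a h → Extends b h
      extends-cong (s , t) (p , q) =
        (λ x → H.trans (cong f (G.sym s) x) (p x)) , (λ x → H.trans (cong f (G.sym t) x) (q x))

      _≟ʰ_ : Decidable (_≗ʰ_ {P} {H})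
      _≟ʰ_ = DecSetoid._≟_ (HomSet.decSetoid P H)

      extends? : ∀ a → U.Decidable (Extends a)
      extends? a h = (to f (source a) ≟ʰ (h ∘ʰ ε₁)) ×-dec (to f (target a) ≟ʰ (h ∘ʰ ε₂))

      extendable : ∀ a → Any (Extends a) (HomSet.homs Q H)
      extendable a with preserve f (isArc a)
      ... | h , eqs = Any.map (λ {g} h≈g → extends-resp a {h} {g} h≈g eqs) (HomSet.homs-enumerates Q H h)

      -- Equal arcs may carry different proofs, and preserve f may answer
      -- these with different homomorphisms; the first one in the
      -- enumeration depends only on the ends of the arc.
      extension : ∀ a → ∃ (Extends a)
      extension a = first (extends? a) (HomSet.homs Q H) (extendable a)

      extension-cong : ∀ {a b} → ArcSet._≈_ G a b → proj₁ (extension a) ≡ proj₁ (extension b)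
      extension-cong {a} {b} a≈b = first-cong (extends? a) (extends? b)
        (λ {h} → extends-cong {a} {b} a≈b {h})
        (λ {h} → extends-cong {b} {a} (G.sym (proj₁ a≈b) , G.sym (proj₂ a≈b)) {h})
        (extendable a) (extendable b)

      f′ : V (Λ G) → V H
      f′ (inj₁ (u , x)) = to (to f u) x
      f′ (inj₂ (a , x)) = to (proj₁ (extension a)) x

      f′-glue : ∀ {s t} → LeftPultr.Glue 𝒯 G s t → f′ s H.≈ f′ t
      f′-glue (same (inj₁ {u , _} {_ , y} (u≈v , x≈y))) = H.trans (cong (to f u) x≈y) (cong f u≈v y)
      f′-glue (same (inj₂ {a , _} {b , _} (a≈b , x≈y))) rewrite extension-cong {a} {b} a≈b =
        cong (proj₁ (extension b)) x≈y
      f′-glue (glue₁ a x) = proj₁ (proj₂ (extension a)) x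
      f′-glue (glue₂ a x) = proj₂ (proj₂ (extension a)) x

      f′-cong : ∀ {s t} → Λ G [ s ≈ t ] → f′ s H.≈ f′ t
      f′-cong = EqC.gfold (Setoid.isEquivalence H.setoid) f′ f′-glue

    -- Together with `unit` this is the adjunction between the left and the central functor:
    -- `Λ G → H` exactly when `G → Γ H`.
    transpose : Hom (Λ G) H
    transpose = record
      { to       = f′
      ; cong     = f′-cong
      ; preserve = λ { (imageP u e p q) → H.⇒-resp (H.sym (f′-cong p)) (H.sym (f′-cong q))
                                            (preserve (to f u) e)
                     ; (imageQ a e p q) → H.⇒-resp (H.sym (f′-cong p)) (H.sym (f′-cong q))
                                            (preserve (proj₁ (extension a)) e) }
      }

  -- Duals carried over by the right adjoint.

  module _ (right : HasRightAdjoint (centralPultr 𝒯)) where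

    private
      Ω = proj₁ right
      module Adjoint G H = Equivalence (proj₂ right G H)

    -- By functoriality of `Γ`, the hypotheses say that `F → G` exactly when `t` fits in `Γ G`.
    -- Failing that, `Γ G` maps to the dual of `t`, which the adjunction turns into a map of `G`.
    hasDual : ∀ t F {g} → Fits (Γ F) t g → (∀ G → ∃ (Fits (Γ G) t) → Hom F G) → HasDual F
    hasDual t F fits hom = obj Ω (Dual.digraph t) ,
      (λ f → fits⇒¬dual t fits (Adjoint.from F (Dual.digraph t) f)) ,
      λ G → Sum.map (hom G) (Adjoint.to G (Dual.digraph t)) (fits⊎dual (Γ G) t)

    hasDual-P : HasDual P
    hasDual-P = hasDual leaf P {idʰ} tt (λ G (g , _) → g)

    -- Arcs of `Γ G` come from homomorphisms `Q → G`; in `Γ Q` the identity gives the arc from `ε₁`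
    -- to `ε₂`.
    hasDual-Q : HasDual Q
    hasDual-Q = hasDual (join leaf down leaf) Q {ε₁}
      (tt , ε₂ , (idʰ , (λ _ → Digraph.refl Q) , (λ _ → Digraph.refl Q)) , tt)
      (λ { G (_ , _ , _ , (h , _) , _) → h })

    hasDual-Λ : ∀ T → IsTree T → HasDual (Λ T)
    hasDual-Λ T tree =
      let t , fits , hom = represent (suc (length (enum T))) ≤-refl tree (IsTree.nonempty tree)
      in hasDual t (Λ T) {to (unit T) (IsTree.nonempty tree)}
           (fits-map {T} {Γ (Λ T)} (unit T) t {IsTree.nonempty tree} fits)
           (λ G (g , p) → transpose {T} {G} (proj₁ (hom (Γ G) g p)))

theorem2p5 : (𝒯 : PultrTemplate) → HasRightAdjoint (centralPultr 𝒯) →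
    (EquivalentToTree (PultrTemplate.P 𝒯) × EquivalentToTree (PultrTemplate.Q 𝒯)) ×
    (∀ T → IsTree T → EquivalentToTree (obj (leftPultr 𝒯) T))
theorem2p5 𝒯 right =
  (hasDual⇒equivalentToTree (hasDual-P 𝒯 right) , hasDual⇒equivalentToTree (hasDual-Q 𝒯 right)) ,
  λ T tree → hasDual⇒equivalentToTree (hasDual-Λ 𝒯 right T tree)
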